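{- Let $\mathbf S$ be a flip-swap language of binary strings of length $n$ that includes the string $0^n$, with $|\mathbf S|>1$. For every $\alpha\in\mathbf S$, the string $f(\alpha)$ is the string immediately following $\alpha$ in the cyclic ordering $\mathcal{BRGC}(\mathbf S)$, where $f$ is defined by (the first applicable case being used) $$f(\alpha)=\begin{cases} 0^n & \text{if }\alpha=0^{n-1}1;\\ flip_\alpha(t_\alpha) & \text{if } w(\alpha)\text{ is even and }(t_\alpha=1\text{ or }flip2_\alpha(t_\alpha-1,t_\alpha)\notin\mathbf S);\\ flip2_\alpha(t_\alpha-1,t_\alpha) & \text{if } w(\alpha)\text{ is even, } t_\alpha>1 \text{ and }flip2_\alpha(t_\alpha-1,t_\alpha)\in\mathbf S;\\ flip2_\alpha(\ell_\alpha,\ell_\alpha+1) & \text{if } w(\alpha)\text{ is odd and }flip_\alpha(\ell_\alpha+1)\notin\mathbf S;\\ flip_\alpha(\ell_\alpha+1) & \text{if } w(\alpha)\text{ is odd and }flip_\alpha(\ell_\alpha+1)\in\mathbf S. \end{cases}$$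
   Context: A flip-swap language (with respect to $1$) is a set $\mathbf S$ of binary strings of length $n$ such that $\mathbf S\cup\{0^n\}$ is closed under the following two operations, whenever applicable: (1) flip (complement) the leftmost $1$; (2) swap the leftmost $1$ with the bit immediately to its right (applicable when the leftmost $1$ exists and is not in the last position). For $\alpha=b_1b_2\cdots b_n$: $w(\alpha)$ is the number of $1$s; $flip_\alpha(i)$ is the string obtained by complementing $b_i$; $flip2_\alpha(i,j)$ is the string obtained by complementing both $b_i$ and $b_j$; $\ell_\alpha$ is the position of the leftmost $1$ of $\alpha$ (or $n+1$ if there is none); $t_\alpha$ is the leftmost position such that $flip_\alpha(t_\alpha)\in\mathbf S$ (it exists when $|\mathbf S|>1$). BRGC order on binary strings of length $n$ is the order of the listing $BRGC(n)$ defined recursively by $BRGC(1)=0,1$ and, for $n>1$, $BRGC(n)=BRGC(n-1)\cdot 0,\ \overline{BRGC}(n-1)\cdot 1$, where $\overline{BRGC}(m)$ is $BRGC(m)$ in reverse order and $\mathcal L\cdot x$ is the listing $\mathcal L$ with $x$ appended to the end of each string. $\mathcal{BRGC}(\mathbf S)$ is the listing of the elements of $\mathbf S$ in the relative order of $BRGC(n)$, regarded cyclically (the first string follows the last). -}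

module Defs where

open import Data.Bool.Base using (Bool; true; false; not; if_then_else_)
import Data.Bool.Properties as Bool
open import Data.List.Base using (List; []; _∷_; _++_; map; reverse; filter; head; last)
open import Data.Maybe.Base using (just)
open import Data.Nat.Base using (ℕ; zero; suc; _+_; _∸_; _≤_; _<_)
import Data.Nat.Properties as ℕ
open import Data.Nat.Divisibility using (_∣?_)
open import Data.Product.Base using (∃₂; _×_)
open import Data.Vec.Base using (Vec; []; _∷_; _∷ʳ_; replicate; count)
open import Data.Vec.Properties using (≡-dec)
open import Function.Base using (_∘_)
open import Level using (Level)
open import Relation.Binary.Definitions using (DecidableEquality)
open import Relation.Binary.PropositionalEquality using (_≡_; _≢_)
open import Relation.Nullary.Decidable using (does; ¬?; _×-dec_; _⊎-dec_)
open import Relation.Unary using (Pred; Decidable; _∈_; _∪_; ｛_｝)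

private variable
  a p : Level
  A : Set a
  n : ℕ

-- The head of the vector is b₁; true is the bit 1.
Bits : ℕ → Set
Bits = Vec Bool

_≟_ : DecidableEquality (Bits n)
_≟_ = ≡-dec Bool._≟_

0^_ : ∀ (n : ℕ) → Bits n
0^ n = replicate n false

w : Bits n → ℕ
w = count (Bool._≟ true)

-- Positions are natural numbers counted from 1, as in b₁b₂⋯bₙ.
-- A position outside 1..n leaves the string unchanged.
flip : Bits n → ℕ → Bits n
flip []      _             = []
flip (b ∷ α) zero          = b ∷ α
flip (b ∷ α) (suc zero)    = not b ∷ α
flip (b ∷ α) (suc (suc i)) = b ∷ flip α (suc i)

-- Complements both bits provided i ≢ j.
flip2 : Bits n → ℕ → ℕ → Bits n
flip2 α i j = flip (flip α i) j

-- Exchanges bᵢ and bᵢ₊₁; unchanged unless 1 ≤ i < n.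
swapNext : Bits n → ℕ → Bits n
swapNext (b ∷ c ∷ α) (suc zero)    = c ∷ b ∷ α
swapNext (b ∷ α)     (suc (suc i)) = b ∷ swapNext α (suc i)
swapNext α           _             = α

-- n + 1 if there is no 1.
ℓ : Bits n → ℕ
ℓ []          = 1
ℓ (true  ∷ _) = 1
ℓ (false ∷ α) = suc (ℓ α)

-- The least i in 1..n satisfying P, or n + 1 if there is none.
leftmost : ∀ (n : ℕ) {P : Pred ℕ p} → Decidable P → ℕ
leftmost zero    P? = 1
leftmost (suc n) P? = if does (P? 1) then 1 else suc (leftmost n (P? ∘ suc))

record FlipSwapLanguage {n : ℕ} {p : Level} (S : Pred (Bits n) p) : Set p where
  field
    flip-closed : ∀ α → α ∈ S ∪ ｛ 0^ n ｝ → ℓ α ≤ n → flip α (ℓ α) ∈ S ∪ ｛ 0^ n ｝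
    swap-closed : ∀ α → α ∈ S ∪ ｛ 0^ n ｝ → ℓ α < n → swapNext α (ℓ α) ∈ S ∪ ｛ 0^ n ｝

-- |S| > 1.
AtLeastTwo : Pred A p → Set _
AtLeastTwo S = ∃₂ λ α β → α ∈ S × β ∈ S × α ≢ β

-- Starting from the one-element listing of the empty string gives BRGC 1 = 0, 1.
BRGC : ∀ (n : ℕ) → List (Bits n)
BRGC zero    = [] ∷ []
BRGC (suc n) = map (_∷ʳ false) (BRGC n) ++ map (_∷ʳ true) (reverse (BRGC n))

𝓑𝓡𝓖𝓒 : {S : Pred (Bits n) p} → Decidable S → List (Bits n)
𝓑𝓡𝓖𝓒 {n = n} S? = filter S? (BRGC n)

-- CyclicNext xs x y: y immediately follows x in xs, regarded cyclically.
data CyclicNext {A : Set a} (xs : List A) (x y : A) : Set a where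
  next : ∀ us vs → xs ≡ us ++ x ∷ y ∷ vs → CyclicNext xs x y
  wrap : last xs ≡ just x → head xs ≡ just y → CyclicNext xs x y

module _ {S : Pred (Bits n) p} (S? : Decidable S) where

  t : Bits n → ℕ
  t α = leftmost n (λ i → S? (flip α i))

-- Strings have length at least 1 here, so that 0ⁿ⁻¹1 makes sense.
module _ {m : ℕ} {S : Pred (Bits (suc m)) p} (S? : Decidable S) where

  f : Bits (suc m) → Bits (suc m)
  f α =
    if does (α ≟ (0^ m ∷ʳ true))
      then 0^ suc m
    else if does (even? ×-dec (tα ℕ.≟ 1 ⊎-dec ¬? (S? (flip2 α (tα ∸ 1) tα))))
      then flip α tα
    else if does (even? ×-dec 1 ℕ.<? tα ×-dec S? (flip2 α (tα ∸ 1) tα))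
      then flip2 α (tα ∸ 1) tα
    else if does (¬? even? ×-dec ¬? (S? (flip α (ℓ α + 1))))
      then flip2 α (ℓ α) (ℓ α + 1)
    else flip α (ℓ α + 1)
    where
    tα = t S? α
    even? = 2 ∣? w α

{-# OPTIONS --safe #-}

-- Prefixing bits instead of appending them, BRGC (n + 1) arises from BRGC n by
-- replacing each α by 0α, 1α if w(α) is even and by 1α, 0α if w(α) is odd.
-- Likewise 𝓑𝓡𝓖𝓒(S) arises from 𝓑𝓡𝓖𝓒(S′), where S′ = {α : 0α ∈ S} is again a
-- flip-swap language, by the same replacement restricted to S.  So the successor
-- of bα is either the other element of the block of α or the first element of
-- the block of the successor f(α) in S′, and it is compared with f(bα) by
-- induction on n.

module Submission where

open import Defs
open import Data.Bool.Base using (Bool; true; false; not; if_then_else_)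
open import Data.Bool.Properties using (not-involutive)
open import Data.List.Base using (List; []; _∷_; _++_; [_]; map; reverse; concatMap; filter; head; last)
open import Data.List.Membership.Propositional using () renaming (_∈_ to _∈ˡ_)
open import Data.List.Membership.Propositional.Properties using (∈-∃++; ∈-filter⁻; ∈-insert)
open import Data.List.Properties
  using (++-assoc; ++-identityʳ; concatMap-++; concatMap-cong; concatMap-map; map-concatMap;
         reverse-++; unfold-reverse; filter-++; filter-accept; filter-reject)
open import Data.List.Relation.Unary.Any using (here)
open import Data.Maybe.Base using (just)
open import Data.Nat.Base using (ℕ; zero; suc; _+_; _∸_; _≤_; _<_; z≤n; s≤s)
import Data.Nat.Properties as ℕ
open import Data.Nat.Divisibility using (_∣?_)
open import Data.Product.Base using (∃; _×_; _,_; proj₂)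
open import Data.Sum.Base using (_⊎_; inj₁; inj₂)
open import Data.Vec.Base using ([]; _∷_; _∷ʳ_)
open import Data.Vec.Properties using (∷-injectiveʳ)
open import Function.Base using (_∘_; case_of_)
open import Level using (Level)
open import Relation.Binary.PropositionalEquality hiding ([_])
open import Relation.Nullary using (¬_; Dec; yes; no; does; contradiction)
open import Relation.Nullary.Decidable using (dec-true; dec-false; ¬?; _⊎-dec_)
open import Relation.Unary using (Pred; Decidable; _∈_; _∉_; _∪_; ｛_｝)

private variable
  a b p : Level
  A : Set a
  B : Set b
  m n : ℕ

-- Ends of lists and cyclic successors in concatenations.

last-∷ʳ : (xs : List A) (x : A) → last (xs ++ [ x ]) ≡ just x
last-∷ʳ []           x = refl
last-∷ʳ (_ ∷ [])     x = refl
last-∷ʳ (_ ∷ y ∷ xs) x = last-∷ʳ (y ∷ xs) x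

last-just : (xs : List A) {x : A} → last xs ≡ just x → ∃ λ ys → xs ≡ ys ++ [ x ]
last-just (x ∷ [])     refl = [] , refl
last-just (x ∷ y ∷ xs) eq with ys , eq′ ← last-just (y ∷ xs) eq = x ∷ ys , cong (x ∷_) eq′

head-just : (xs : List A) {x : A} → head xs ≡ just x → ∃ λ ys → xs ≡ x ∷ ys
head-just (x ∷ xs) refl = xs , refl

reverse-concatMap : (g : A → List B) (xs : List A) →
  reverse (concatMap g xs) ≡ concatMap (reverse ∘ g) (reverse xs)
reverse-concatMap g []       = refl
reverse-concatMap g (x ∷ xs) = begin
  reverse (g x ++ concatMap g xs)
    ≡⟨ reverse-++ (g x) (concatMap g xs) ⟩
  reverse (concatMap g xs) ++ reverse (g x)
    ≡⟨ cong₂ _++_ (reverse-concatMap g xs) (sym (++-identityʳ _)) ⟩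
  concatMap (reverse ∘ g) (reverse xs) ++ concatMap (reverse ∘ g) [ x ]
    ≡⟨ sym (concatMap-++ (reverse ∘ g) (reverse xs) [ x ]) ⟩
  concatMap (reverse ∘ g) (reverse xs ++ [ x ])
    ≡⟨ cong (concatMap (reverse ∘ g)) (sym (unfold-reverse x xs)) ⟩
  concatMap (reverse ∘ g) (reverse (x ∷ xs)) ∎
  where open ≡-Reasoning

CyclicNext⇒∈ˡ : {xs : List A} {x y : A} → CyclicNext xs x y → x ∈ˡ xs
CyclicNext⇒∈ˡ (next us vs refl) = ∈-insert us
CyclicNext⇒∈ˡ {xs = xs} (wrap l _) with us , refl ← last-just xs l = ∈-insert us

CyclicNext⇒∈ʳ : {xs : List A} {x y : A} → CyclicNext xs x y → y ∈ˡ xs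
CyclicNext⇒∈ʳ {x = x} {y} (next us vs refl) =
  subst (y ∈ˡ_) (++-assoc us [ x ] (y ∷ vs)) (∈-insert (us ++ [ x ]))
CyclicNext⇒∈ʳ {xs = _ ∷ _} (wrap _ refl) = here refl

-- `g y` comes directly after `g x` in the concatenation, so the last element of the one meets the
-- first of the other. In the `wrap` case `g x` closes the whole concatenation and `g y` opens it.
CyclicNext-concatMap : (g : A → List B) {xs : List A} {x y : A} {u v : B} →
  CyclicNext xs x y → last (g x) ≡ just u → head (g y) ≡ just v → CyclicNext (concatMap g xs) u v
CyclicNext-concatMap g {x = x} {y} {u} {v} (next us vs refl) lu hv
  with ps , eqx ← last-just (g x) lu | qs , eqy ← head-just (g y) hv
  = next (concatMap g us ++ ps) (qs ++ concatMap g vs) (begin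
      concatMap g (us ++ x ∷ y ∷ vs)
        ≡⟨ concatMap-++ g us (x ∷ y ∷ vs) ⟩
      concatMap g us ++ g x ++ g y ++ concatMap g vs
        ≡⟨ cong (concatMap g us ++_) (cong₂ (λ l r → l ++ r ++ concatMap g vs) eqx eqy) ⟩
      concatMap g us ++ (ps ++ [ u ]) ++ v ∷ qs ++ concatMap g vs
        ≡⟨ cong (concatMap g us ++_) (++-assoc ps [ u ] _) ⟩
      concatMap g us ++ ps ++ u ∷ v ∷ qs ++ concatMap g vs
        ≡⟨ sym (++-assoc (concatMap g us) ps _) ⟩
      (concatMap g us ++ ps) ++ u ∷ v ∷ qs ++ concatMap g vs ∎)
  where open ≡-Reasoning
CyclicNext-concatMap g {xs} {x} {y} {u} {v} (wrap l h) lu hv = wrap lst hd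
  where
  lst : last (concatMap g xs) ≡ just u
  lst with us , refl ← last-just xs l | ps , eqx ← last-just (g x) lu
    rewrite concatMap-++ g us [ x ] | ++-identityʳ (g x) | eqx | sym (++-assoc (concatMap g us) ps [ u ])
    = last-∷ʳ (concatMap g us ++ ps) u

  hd : head (concatMap g xs) ≡ just v
  hd with _ , refl ← head-just xs h | _ , eqy ← head-just (g y) hv rewrite eqy = refl

CyclicNext-inner : (g : A → List B) {xs : List A} {x : A} {u v : B} →
  x ∈ˡ xs → g x ≡ u ∷ v ∷ [] → CyclicNext (concatMap g xs) u v
CyclicNext-inner g {x = x} x∈xs eq with us , vs , refl ← ∈-∃++ x∈xs
  = next (concatMap g us) (concatMap g vs)
      (trans (concatMap-++ g us (x ∷ vs)) (cong (λ l → concatMap g us ++ l ++ concatMap g vs) eq))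

-- Parity of the weight.

even : Bits n → Bool
even []          = true
even (true  ∷ α) = not (even α)
even (false ∷ α) = even α

2∣?-suc : ∀ n → does (2 ∣? suc n) ≡ not (does (2 ∣? n))
2∣?-suc zero    = refl
-- `does (2 ∣? suc (suc n))` reduces to `does (2 ∣? n)`, so the claim is the previous one read
-- backwards under `not`.
2∣?-suc (suc n) = trans (sym (not-involutive _)) (cong not (sym (2∣?-suc n)))

2∣?w : (α : Bits n) → does (2 ∣? w α) ≡ even α
2∣?w []          = refl
2∣?w (true  ∷ α) = trans (2∣?-suc (w α)) (cong not (2∣?w α))
2∣?w (false ∷ α) = 2∣?w α

even-∷ʳ-false : (α : Bits n) → even (α ∷ʳ false) ≡ even α
even-∷ʳ-false []          = refl
even-∷ʳ-false (true  ∷ α) = cong not (even-∷ʳ-false α)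
even-∷ʳ-false (false ∷ α) = even-∷ʳ-false α

even-∷ʳ-true : (α : Bits n) → even (α ∷ʳ true) ≡ not (even α)
even-∷ʳ-true []          = refl
even-∷ʳ-true (true  ∷ α) = cong not (even-∷ʳ-true α)
even-∷ʳ-true (false ∷ α) = even-∷ʳ-true α

even-0^ : ∀ n → even (0^ n) ≡ true
even-0^ zero    = refl
even-0^ (suc n) = even-0^ n

even-flip : (α : Bits n) {i : ℕ} → 0 < i → i ≤ n → even (flip α i) ≡ not (even α)
even-flip (true  ∷ α) {suc zero}    _ _       = sym (not-involutive _)
even-flip (false ∷ α) {suc zero}    _ _       = refl
even-flip (true  ∷ α) {suc (suc i)} _ (s≤s h) = cong not (even-flip α (s≤s z≤n) h)
even-flip (false ∷ α) {suc (suc i)} _ (s≤s h) = even-flip α (s≤s z≤n) h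

even-flip2 : (α : Bits n) {i j : ℕ} → 0 < i → i ≤ n → 0 < j → j ≤ n → even (flip2 α i j) ≡ even α
even-flip2 α 0<i i≤n 0<j j≤n =
  trans (even-flip (flip α _) 0<j j≤n) (trans (cong not (even-flip α 0<i i≤n)) (not-involutive _))

-- The reflected Gray code built by prefixing.

block : Bits n → List (Bits (suc n))
block α = if even α then (false ∷ α) ∷ (true ∷ α) ∷ [] else (true ∷ α) ∷ (false ∷ α) ∷ []

block-∷ʳ-false : (α : Bits n) → block (α ∷ʳ false) ≡ map (_∷ʳ false) (block α)
block-∷ʳ-false α rewrite even-∷ʳ-false α with even α
... | true  = refl
... | false = refl

-- The appended 1 changes the parity and so turns the block around; this matches the reversal in the
-- second half of `BRGC`.
block-∷ʳ-true : (α : Bits n) → block (α ∷ʳ true) ≡ map (_∷ʳ true) (reverse (block α))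
block-∷ʳ-true α rewrite even-∷ʳ-true α with even α
... | true  = refl
... | false = refl

-- The recursion defining BRGC appends the last bit; the successor rule acts on
-- the leftmost 1, so the reflection is moved to the first bit.
BRGC-suc : ∀ n → BRGC (suc n) ≡ concatMap block (BRGC n)
BRGC-suc zero    = refl
BRGC-suc (suc n) = begin
  map (_∷ʳ false) (BRGC (suc n)) ++ map (_∷ʳ true) (reverse (BRGC (suc n)))
    ≡⟨ cong (λ l → map (_∷ʳ false) l ++ map (_∷ʳ true) (reverse l)) (BRGC-suc n) ⟩
  map (_∷ʳ false) (concatMap block L) ++ map (_∷ʳ true) (reverse (concatMap block L))
    ≡⟨ cong₂ _++_ zeros ones ⟩
  concatMap block (map (_∷ʳ false) L) ++ concatMap block (map (_∷ʳ true) (reverse L))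
    ≡⟨ sym (concatMap-++ block (map (_∷ʳ false) L) _) ⟩
  concatMap block (BRGC (suc n)) ∎
  where
  open ≡-Reasoning
  L : List (Bits n)
  L = BRGC n

  zeros : map (_∷ʳ false) (concatMap block L) ≡ concatMap block (map (_∷ʳ false) L)
  zeros = begin
    map (_∷ʳ false) (concatMap block L)
      ≡⟨ map-concatMap (_∷ʳ false) block L ⟩
    concatMap (map (_∷ʳ false) ∘ block) L
      ≡⟨ concatMap-cong (sym ∘ block-∷ʳ-false) L ⟩
    concatMap (block ∘ (_∷ʳ false)) L
      ≡⟨ sym (concatMap-map block (_∷ʳ false) L) ⟩
    concatMap block (map (_∷ʳ false) L) ∎

  ones : map (_∷ʳ true) (reverse (concatMap block L)) ≡ concatMap block (map (_∷ʳ true) (reverse L))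
  ones = begin
    map (_∷ʳ true) (reverse (concatMap block L))
      ≡⟨ cong (map (_∷ʳ true)) (reverse-concatMap block L) ⟩
    map (_∷ʳ true) (concatMap (reverse ∘ block) (reverse L))
      ≡⟨ map-concatMap (_∷ʳ true) (reverse ∘ block) (reverse L) ⟩
    concatMap (map (_∷ʳ true) ∘ reverse ∘ block) (reverse L)
      ≡⟨ concatMap-cong (sym ∘ block-∷ʳ-true) (reverse L) ⟩
    concatMap (block ∘ (_∷ʳ true)) (reverse L)
      ≡⟨ sym (concatMap-map block (_∷ʳ true) (reverse L)) ⟩
    concatMap block (map (_∷ʳ true) (reverse L)) ∎

-- Positions: shifts under prefixing, the leftmost 1, and least positions.

flip-∷ : (b : Bool) (α : Bits n) {i : ℕ} → 0 < i → flip (b ∷ α) (suc i) ≡ b ∷ flip α i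
flip-∷ b α {suc i} _ = refl

flip2-∷ : (b : Bool) (α : Bits n) {i j : ℕ} → 0 < i → 0 < j → flip2 (b ∷ α) (suc i) (suc j) ≡ b ∷ flip2 α i j
flip2-∷ b α {suc i} {suc j} _ _ = refl

0<ℓ : (α : Bits n) → 0 < ℓ α
0<ℓ []          = s≤s z≤n
0<ℓ (true  ∷ α) = s≤s z≤n
0<ℓ (false ∷ α) = s≤s z≤n

-- An odd string contains a 1, and only `0^ m ∷ʳ true` has its leftmost 1 in the last place. In the
-- odd cases of `f` this makes `ℓ α + 1` a genuine position.
odd⇒ℓ≤ : (α : Bits (suc m)) → even α ≡ false → α ≢ 0^ m ∷ʳ true → ℓ α ≤ m
odd⇒ℓ≤ {zero}  (true  ∷ [])    _   α≢ = contradiction refl α≢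
odd⇒ℓ≤ {suc m} (true  ∷ α)     _   _  = s≤s z≤n
odd⇒ℓ≤ {suc m} (false ∷ α)     odd α≢ = s≤s (odd⇒ℓ≤ α odd (α≢ ∘ cong (false ∷_)))

leftmost-cong : ∀ n {P : Pred ℕ p} {Q : Pred ℕ p} (P? : Decidable P) (Q? : Decidable Q) →
  (∀ i → does (P? (suc i)) ≡ does (Q? (suc i))) → leftmost n P? ≡ leftmost n Q?
leftmost-cong zero    P? Q? eq = refl
leftmost-cong (suc n) P? Q? eq rewrite eq 0 | leftmost-cong n (P? ∘ suc) (Q? ∘ suc) (eq ∘ suc) = refl

leftmost-least : ∀ n {P : Pred ℕ p} (P? : Decidable P) {i} → i < n → P (suc i) →
  ∃ λ k → leftmost n P? ≡ suc k × k < n × (∀ j → j < k → ¬ P (suc j))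
leftmost-least (suc n) P? {i} i<n Pi with P? 1
... | yes _ = 0 , refl , s≤s z≤n , λ _ ()
leftmost-least (suc n) P? {zero}  i<n       Pi | no ¬P1 = contradiction Pi ¬P1
leftmost-least (suc n) P? {suc i} (s≤s i<n) Pi | no ¬P1
  with k , eq , k<n , min ← leftmost-least n (P? ∘ suc) i<n Pi
  = suc k , cong suc eq , s≤s k<n , λ { zero _ → ¬P1 ; (suc j) (s≤s j<k) → min j j<k }

-- The cases of `f`, with their guards as hypotheses.

module _ {S : Pred (Bits (suc m)) p} (S? : Decidable S) (α : Bits (suc m)) where

  private
    even⇒≢ : even α ≡ true → α ≢ 0^ m ∷ʳ true
    even⇒≢ e refl = case trans (sym e) (trans (even-∷ʳ-true (0^ m)) (cong not (even-0^ m))) of λ ()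

  f-last : α ≡ 0^ m ∷ʳ true → f S? α ≡ 0^ suc m
  f-last eq rewrite dec-true (α ≟ (0^ m ∷ʳ true)) eq = refl

  f-even-flip : ∀ {i} → even α ≡ true → t S? α ≡ i → i ≡ 1 ⊎ flip2 α (i ∸ 1) i ∉ S →
    f S? α ≡ flip α i
  f-even-flip {i} e refl h
    rewrite dec-false (α ≟ (0^ m ∷ʳ true)) (even⇒≢ e)
          | 2∣?w α | e
          | dec-true (i ℕ.≟ 1 ⊎-dec ¬? (S? (flip2 α (i ∸ 1) i))) h = refl

  f-even-flip2 : ∀ {i} → even α ≡ true → t S? α ≡ i → 1 < i → flip2 α (i ∸ 1) i ∈ S →
    f S? α ≡ flip2 α (i ∸ 1) i
  f-even-flip2 {i} e refl 1<i h
    rewrite dec-false (α ≟ (0^ m ∷ʳ true)) (even⇒≢ e)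
          | 2∣?w α | e
          | dec-false (i ℕ.≟ 1) (ℕ.>⇒≢ 1<i)
          | dec-true (S? (flip2 α (i ∸ 1) i)) h
          | dec-true (1 ℕ.<? i) 1<i = refl

  f-odd-flip2 : even α ≡ false → α ≢ 0^ m ∷ʳ true → flip α (ℓ α + 1) ∉ S →
    f S? α ≡ flip2 α (ℓ α) (ℓ α + 1)
  f-odd-flip2 e ≢last h
    rewrite dec-false (α ≟ (0^ m ∷ʳ true)) ≢last
          | 2∣?w α | e
          | dec-false (S? (flip α (ℓ α + 1))) h = refl

  f-odd-flip : even α ≡ false → α ≢ 0^ m ∷ʳ true → flip α (ℓ α + 1) ∈ S →
    f S? α ≡ flip α (ℓ α + 1)
  f-odd-flip e ≢last h
    rewrite dec-false (α ≟ (0^ m ∷ʳ true)) ≢last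
          | 2∣?w α | e
          | dec-true (S? (flip α (ℓ α + 1))) h = refl

-- Tails of a language and the ends of its filtered blocks.

-- By flip-closure these are the tails of all strings of S.
Tails : Pred (Bits (suc n)) p → Pred (Bits n) p
Tails S = S ∘ (false ∷_)

Tails? : {S : Pred (Bits (suc n)) p} → Decidable S → Decidable (Tails S)
Tails? S? = S? ∘ (false ∷_)

module _ {S : Pred (Bits (suc n)) p} (S? : Decidable S) where

  head-even : (α : Bits n) → even α ≡ true → false ∷ α ∈ S →
    head (filter S? (block α)) ≡ just (false ∷ α)
  head-even α e h rewrite e | filter-accept S? {xs = [ true ∷ α ]} h = refl

  head-odd-1 : (α : Bits n) → even α ≡ false → true ∷ α ∈ S →
    head (filter S? (block α)) ≡ just (true ∷ α)
  head-odd-1 α e h rewrite e | filter-accept S? {xs = [ false ∷ α ]} h = refl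

  head-odd-0 : (α : Bits n) → even α ≡ false → true ∷ α ∉ S → false ∷ α ∈ S →
    head (filter S? (block α)) ≡ just (false ∷ α)
  head-odd-0 α e h h′
    rewrite e | filter-reject S? {xs = [ false ∷ α ]} h | filter-accept S? {xs = []} h′ = refl

  last-odd : (α : Bits n) → even α ≡ false → false ∷ α ∈ S →
    last (filter S? (block α)) ≡ just (false ∷ α)
  last-odd α e h
    rewrite e | filter-++ S? [ true ∷ α ] [ false ∷ α ] | filter-accept S? {xs = []} h
    = last-∷ʳ (filter S? [ true ∷ α ]) (false ∷ α)

  last-even-1 : (α : Bits n) → even α ≡ true → true ∷ α ∈ S →
    last (filter S? (block α)) ≡ just (true ∷ α)
  last-even-1 α e h
    rewrite e | filter-++ S? [ false ∷ α ] [ true ∷ α ] | filter-accept S? {xs = []} h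
    = last-∷ʳ (filter S? [ false ∷ α ]) (true ∷ α)

  last-even-0 : (α : Bits n) → even α ≡ true → true ∷ α ∉ S → false ∷ α ∈ S →
    last (filter S? (block α)) ≡ just (false ∷ α)
  last-even-0 α e h h′
    rewrite e | filter-accept S? {xs = [ true ∷ α ]} h′ | filter-reject S? {xs = []} h = refl

  block-even : (α : Bits n) → even α ≡ true → false ∷ α ∈ S → true ∷ α ∈ S →
    filter S? (block α) ≡ (false ∷ α) ∷ (true ∷ α) ∷ []
  block-even α e h h′
    rewrite e | filter-accept S? {xs = [ true ∷ α ]} h | filter-accept S? {xs = []} h′ = refl

  block-odd : (α : Bits n) → even α ≡ false → false ∷ α ∈ S → true ∷ α ∈ S →
    filter S? (block α) ≡ (true ∷ α) ∷ (false ∷ α) ∷ []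
  block-odd α e h h′
    rewrite e | filter-accept S? {xs = [ false ∷ α ]} h′ | filter-accept S? {xs = []} h = refl

  t-here : {α : Bits n} {b : Bool} → not b ∷ α ∈ S → t S? (b ∷ α) ≡ 1
  t-here {α} {b} h rewrite dec-true (S? (not b ∷ α)) h = refl

  t-there : {α : Bits n} → true ∷ α ∉ S → t S? (false ∷ α) ≡ suc (t (Tails? S?) α)
  t-there {α} h rewrite dec-false (S? (true ∷ α)) h =
    cong suc (leftmost-cong n (λ i → S? (flip (false ∷ α) (suc i))) (λ i → Tails? S? (flip α i)) (λ _ → refl))

-- Consequences of flip-swap closure.

module _ {S : Pred (Bits (suc n)) p} (L : FlipSwapLanguage S) where
  open FlipSwapLanguage L

  -- A leading 0 shifts the leftmost 1 by one place and is untouched by both operations there, so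
  -- closure passes to the tails.
  FlipSwapLanguage-Tails : FlipSwapLanguage (Tails S)
  FlipSwapLanguage-Tails = record
    { flip-closed = λ α α∈ ℓ≤n → back (subst (_∈ S∪0) (flip-∷ false α (0<ℓ α))
                      (flip-closed (false ∷ α) (up α∈) (s≤s ℓ≤n)))
    ; swap-closed = λ α α∈ ℓ<n → back (subst (_∈ S∪0) (swapNext-∷ α (0<ℓ α))
                      (swap-closed (false ∷ α) (up α∈) (s≤s ℓ<n)))
    }
    where
    S∪0 : Pred (Bits (suc n)) _
    S∪0 = S ∪ ｛ 0^ suc n ｝

    up : {α : Bits n} → α ∈ Tails S ∪ ｛ 0^ n ｝ → false ∷ α ∈ S∪0
    up (inj₁ h)    = inj₁ h
    up (inj₂ refl) = inj₂ refl

    back : {α : Bits n} → false ∷ α ∈ S∪0 → α ∈ Tails S ∪ ｛ 0^ n ｝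
    back (inj₁ h) = inj₁ h
    back (inj₂ h) = inj₂ (∷-injectiveʳ h)

    swapNext-∷ : (α : Bits n) {i : ℕ} → 0 < i → swapNext (false ∷ α) (suc i) ≡ false ∷ swapNext α i
    swapNext-∷ []      {suc i} _ = refl
    swapNext-∷ (_ ∷ _) {suc i} _ = refl

  module _ (0∈S : 0^ suc n ∈ S) where

    private
      drop-∪ : {α : Bits (suc n)} → α ∈ S ∪ ｛ 0^ suc n ｝ → α ∈ S
      drop-∪ (inj₁ h)    = h
      drop-∪ (inj₂ refl) = 0∈S

    flip₁ : {α : Bits n} → true ∷ α ∈ S → false ∷ α ∈ S
    flip₁ {α} h = drop-∪ (flip-closed (true ∷ α) (inj₁ h) (s≤s z≤n))

swap₁ : {S : Pred (Bits (suc (suc n))) p} → FlipSwapLanguage S →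
  {α : Bits n} → true ∷ false ∷ α ∈ S → false ∷ true ∷ α ∈ S
swap₁ L {α} h with FlipSwapLanguage.swap-closed L (true ∷ false ∷ α) (inj₁ h) (s≤s (s≤s z≤n))
-- The swapped string contains a 1, hence is not the zero string.
... | inj₁ h′ = h′

-- Minimality of t makes the bits before position t zero, since a leftmost 1 can
-- always be flipped; the leading 1 is then swapped rightwards to position t − 1.
slide-flip : {S : Pred (Bits (suc n)) p} → FlipSwapLanguage S → 0^ suc n ∈ S →
  (α : Bits n) (k : ℕ) → false ∷ α ∈ S → (∀ i → i < suc k → false ∷ flip α (suc i) ∉ S) →
  true ∷ flip α (suc (suc k)) ∈ S → false ∷ flip2 α (suc k) (suc (suc k)) ∈ S
slide-flip L 0∈S []          k       α∈S min h = flip₁ L 0∈S h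
slide-flip L 0∈S (true ∷ α)  k       α∈S min h =
  contradiction (flip₁ (FlipSwapLanguage-Tails L) 0∈S α∈S) (min 0 (s≤s z≤n))
slide-flip L 0∈S (false ∷ α) zero    α∈S min h = swap₁ L h
slide-flip L 0∈S (false ∷ α) (suc k) α∈S min h =
  slide-flip (FlipSwapLanguage-Tails L) 0∈S α k α∈S (λ i i≤k → min (suc i) (s≤s i≤k)) (swap₁ L h)

-- Complementing the leftmost 1 of `α` leaves zeros up to position `ℓ α`. Swaps carry the prefixed 1
-- through them to that position, which undoes this complement.
slide-flip2 : {S : Pred (Bits (suc n)) p} → FlipSwapLanguage S → 0^ suc n ∈ S →
  (α : Bits n) → true ∷ flip2 α (ℓ α) (ℓ α + 1) ∈ S → false ∷ flip α (ℓ α + 1) ∈ S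
slide-flip2 L 0∈S []          h = flip₁ L 0∈S h
slide-flip2 L 0∈S (true ∷ []) h = swap₁ L h
slide-flip2 L 0∈S (true ∷ _ ∷ _) h = swap₁ L h
slide-flip2 {S = S} L 0∈S (false ∷ α) h =
  subst (λ β → false ∷ β ∈ S) (sym (flip-∷ false α 0<ℓ+1))
    (slide-flip2 (FlipSwapLanguage-Tails L) 0∈S α
      (swap₁ L (subst (λ β → true ∷ β ∈ S) (flip2-∷ false α (0<ℓ α) 0<ℓ+1) h)))
  where
  0<ℓ+1 : 0 < ℓ α + 1
  0<ℓ+1 = ℕ.m≤n⇒m≤n+o 1 (0<ℓ α)

-- The leftmost 1 is swapped past a following 0 and flipped away before a following 1, until a
-- single 1 in the last place remains.
nonzero⇒last∈ : {S : Pred (Bits (suc m)) p} → FlipSwapLanguage S → 0^ suc m ∈ S →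
  (α : Bits (suc m)) → α ∈ S → α ≢ 0^ suc m → 0^ m ∷ʳ true ∈ S
nonzero⇒last∈ {m = zero}  L 0∈S (true  ∷ [])        α∈S α≢0 = α∈S
nonzero⇒last∈ {m = zero}  L 0∈S (false ∷ [])        α∈S α≢0 = contradiction refl α≢0
nonzero⇒last∈ {m = suc m} L 0∈S (false ∷ α)         α∈S α≢0 =
  nonzero⇒last∈ (FlipSwapLanguage-Tails L) 0∈S α α∈S (α≢0 ∘ cong (false ∷_))
nonzero⇒last∈ {m = suc m} L 0∈S (true  ∷ true  ∷ α) α∈S α≢0 =
  nonzero⇒last∈ (FlipSwapLanguage-Tails L) 0∈S (true ∷ α) (flip₁ L 0∈S α∈S) λ ()
nonzero⇒last∈ {m = suc m} L 0∈S (true  ∷ false ∷ α) α∈S α≢0 =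
  nonzero⇒last∈ (FlipSwapLanguage-Tails L) 0∈S (true ∷ α) (swap₁ L α∈S) λ ()

AtLeastTwo⇒last∈ : {S : Pred (Bits (suc m)) p} → FlipSwapLanguage S → 0^ suc m ∈ S →
  AtLeastTwo S → 0^ m ∷ʳ true ∈ S
AtLeastTwo⇒last∈ {m = m} L 0∈S (α , β , α∈S , β∈S , α≢β) with α ≟ (0^ suc m)
... | no  α≢0  = nonzero⇒last∈ L 0∈S α α∈S α≢0
... | yes refl = nonzero⇒last∈ L 0∈S β β∈S (α≢β ∘ sym)

-- A leftmost 1 can be flipped; the zero string can have its last bit flipped because `0^ m ∷ʳ true`
-- is in `S`. So the position `t` exists.
flip-∈ : {S : Pred (Bits (suc m)) p} → FlipSwapLanguage S → 0^ suc m ∈ S → 0^ m ∷ʳ true ∈ S →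
  (α : Bits (suc m)) → α ∈ S → ∃ λ i → i < suc m × flip α (suc i) ∈ S
flip-∈             L 0∈S l∈S (true  ∷ α)  α∈S = 0 , s≤s z≤n , flip₁ L 0∈S α∈S
flip-∈ {m = zero}  L 0∈S l∈S (false ∷ []) α∈S = 0 , s≤s z≤n , l∈S
flip-∈ {m = suc m} L 0∈S l∈S (false ∷ α)  α∈S
  with i , i<m , h ← flip-∈ (FlipSwapLanguage-Tails L) 0∈S l∈S α α∈S = suc i , s≤s i<m , h

-- If `false ∷ α` is outside `S`, so is `true ∷ α` by flip-closure, and the whole block disappears.
-- The remaining blocks are those of the tails.
filter-concatMap-block : {S : Pred (Bits (suc n)) p} (S? : Decidable S) →
  FlipSwapLanguage S → 0^ suc n ∈ S → (αs : List (Bits n)) →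
  filter S? (concatMap block αs) ≡ concatMap (filter S? ∘ block) (filter (Tails? S?) αs)
filter-concatMap-block S? L 0∈S [] = refl
filter-concatMap-block S? L 0∈S (α ∷ αs)
  rewrite filter-++ S? (block α) (concatMap block αs) | filter-concatMap-block S? L 0∈S αs
  with Tails? S? α
... | yes _  = refl
... | no ∉S = cong (_++ concatMap (filter S? ∘ block) (filter (Tails? S?) αs)) empty
  where
  empty : filter S? (block α) ≡ []
  empty with even α
  ... | true  = trans (filter-reject S? ∉S) (filter-reject S? (∉S ∘ flip₁ L 0∈S))
  ... | false = trans (filter-reject S? (∉S ∘ flip₁ L 0∈S)) (filter-reject S? ∉S)

-- Flipping the first bit of `α` stays among the tails: two flips turn a prefix 11 into 00, one swap
-- turns 10 into 01.
1∷∈⇒t≡1 : {S : Pred (Bits (suc (suc m))) p} (S? : Decidable S) → FlipSwapLanguage S →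
  0^ suc (suc m) ∈ S → (α : Bits (suc m)) → true ∷ α ∈ S → t (Tails? S?) α ≡ 1
1∷∈⇒t≡1 S? L 0∈S (true  ∷ α) h =
  t-here (Tails? S?) (flip₁ (FlipSwapLanguage-Tails L) 0∈S (flip₁ L 0∈S h))
1∷∈⇒t≡1 S? L 0∈S (false ∷ α) h = t-here (Tails? S?) (swap₁ L h)

-- Comparison of `f` on `b ∷ α` with `f` on `α`.

module _ {S : Pred (Bits (suc (suc m))) p} (S? : Decidable S) (L : FlipSwapLanguage S)
  (0∈S : 0^ suc (suc m) ∈ S) (l∈S : 0^ suc m ∷ʳ true ∈ S)
  (α : Bits (suc m)) (α∈ : α ∈ Tails S) (fα∈ : f (Tails? S?) α ∈ Tails S)
  where

  private
    S′? : Decidable (Tails S)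
    S′? = Tails? S?

    -- This is what must hold when `b ∷ α` is the last element of its own filtered block: its image
    -- under `f` opens the block of the next tail.
    HeadNext : Bool → Set
    HeadNext b = head (filter S? (block (f S′? α))) ≡ just (f S? (b ∷ α))

    via : ∀ b {β γ} → f S′? α ≡ β → f S? (b ∷ α) ≡ γ →
      (β ∈ Tails S → head (filter S? (block β)) ≡ just γ) → HeadNext b
    via _ refl refl h = h fα∈

    odd-flip₁ : even α ≡ true → even (flip α 1) ≡ false
    odd-flip₁ e = trans (even-flip α (s≤s z≤n) (s≤s z≤n)) (cong not e)

  head-f-false-even : even α ≡ true → true ∷ α ∉ S → HeadNext false
  -- `flip-∈` excludes the default value of `leftmost`, so `t` of `α` is a genuine position `suc k`.
  head-f-false-even e 1α∉ = case flip-∈ (FlipSwapLanguage-Tails L) 0∈S l∈S α α∈ of λ where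
      (i , i<n , h) → case leftmost-least (suc m) (λ i → S′? (flip α i)) i<n h of λ where
        (k , t′≡ , k<n , min) → by-t k t′≡ (trans (t-there S? 1α∉) (cong suc t′≡)) k<n min
    where
    by-t : ∀ k → t S′? α ≡ suc k → t S? (false ∷ α) ≡ suc (suc k) → k < suc m →
      (∀ i → i < k → flip α (suc i) ∉ Tails S) → HeadNext false
    -- Position `t - 1` of `false ∷ α` is now the prefixed bit. The test in `f` thus asks whether
    -- the odd string `flip α 1` has its 1-prefixed element in `S`, which would come first in the
    -- block.
    by-t zero t′≡ t≡ _ _ = case S? (true ∷ flip α 1) of λ where
        (yes h) → via false f′≡ (f-even-flip2 S? (false ∷ α) e t≡ (s≤s (s≤s z≤n)) h) λ _ →
                    head-odd-1 S? (flip α 1) (odd-flip₁ e) h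
        (no ¬h) → via false f′≡ (f-even-flip S? (false ∷ α) e t≡ (inj₂ ¬h))
                    (head-odd-0 S? (flip α 1) (odd-flip₁ e) ¬h)
      where
      f′≡ : f S′? α ≡ flip α 1
      f′≡ = f-even-flip S′? α e t′≡ (inj₁ refl)
    by-t (suc k) t′≡ t≡ k<n min = case S′? (flip2 α (suc k) (suc (suc k))) of λ where
        (yes h) → via false (f-even-flip2 S′? α e t′≡ (s≤s (s≤s z≤n)) h)
                              (f-even-flip2 S? (false ∷ α) e t≡ (s≤s (s≤s z≤n)) h)
                    (head-even S? (flip2 α (suc k) (suc (suc k)))
                      (trans (even-flip2 α (s≤s z≤n) (ℕ.<⇒≤ k<n) (s≤s z≤n) k<n) e))
        -- The new tail is odd, so its 1-prefixed element would come first. By `slide-flip` its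
        -- membership would make the rejected `flip2` admissible.
        (no ¬h) → via false (f-even-flip S′? α e t′≡ (inj₂ ¬h)) (f-even-flip S? (false ∷ α) e t≡ (inj₂ ¬h))
                    (head-odd-0 S? (flip α (suc (suc k)))
                      (trans (even-flip α (s≤s z≤n) k<n) (cong not e))
                      (¬h ∘ slide-flip L 0∈S α k α∈ min))

  -- The prefixed 0 shifts `ℓ` by one, so the same case of `f` applies to `α` and to `false ∷ α`. An
  -- even new tail lists its 0-prefixed element first; for an odd one `slide-flip2` excludes the
  -- 1-prefixed element.
  head-f-false-odd : even α ≡ false → HeadNext false
  head-f-false-odd e = case α ≟ (0^ m ∷ʳ true) of λ where
      (yes α≡) → via false (f-last S′? α α≡) (f-last S? (false ∷ α) (cong (false ∷_) α≡))
                   (head-even S? (0^ suc m) (even-0^ m))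
      (no  α≢) → not-last α≢
    where
    not-last : α ≢ 0^ m ∷ʳ true → HeadNext false
    not-last α≢ = case S′? (flip α (ℓ α + 1)) of λ where
        (yes h) → via false (f-odd-flip S′? α e α≢ h)
                    (trans (f-odd-flip S? (false ∷ α) e false∷α≢ (subst (_∈ S) (sym flip≡) h)) flip≡)
                    (head-even S? (flip α (ℓ α + 1)) (trans (even-flip α 0<ℓ+1 ℓ+1≤) (cong not e)))
        (no ¬h) → via false (f-odd-flip2 S′? α e α≢ ¬h)
                    (trans (f-odd-flip2 S? (false ∷ α) e false∷α≢ (¬h ∘ subst (_∈ S) flip≡))
                           (flip2-∷ false α (0<ℓ α) 0<ℓ+1))
                    (head-odd-0 S? (flip2 α (ℓ α) (ℓ α + 1))
                      (trans (even-flip2 α (0<ℓ α) ℓ≤ 0<ℓ+1 ℓ+1≤) e)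
                      (¬h ∘ slide-flip2 L 0∈S α))
      where
      false∷α≢ : false ∷ α ≢ 0^ suc m ∷ʳ true
      false∷α≢ = α≢ ∘ ∷-injectiveʳ

      0<ℓ+1 : 0 < ℓ α + 1
      0<ℓ+1 = ℕ.m≤n⇒m≤n+o 1 (0<ℓ α)

      ℓ+1≤ : ℓ α + 1 ≤ suc m
      ℓ+1≤ = subst (_≤ suc m) (ℕ.+-comm 1 (ℓ α)) (s≤s (odd⇒ℓ≤ α e α≢))

      ℓ≤ : ℓ α ≤ suc m
      ℓ≤ = ℕ.m≤n⇒m≤1+n (odd⇒ℓ≤ α e α≢)

      flip≡ : flip (false ∷ α) (suc (ℓ α + 1)) ≡ false ∷ flip α (ℓ α + 1)
      flip≡ = flip-∷ false α 0<ℓ+1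

  -- Here `true ∷ α` is odd with its leftmost 1 in front, so `f` complements the first bit of `α`,
  -- just as `f` on `α` does because `t` is 1 there. Whether the prefixed 1 stays depends on the
  -- membership that also decides the first element of the block.
  head-f-true-even : even α ≡ true → true ∷ α ∈ S → HeadNext true
  head-f-true-even e 1α∈ = case S? (true ∷ flip α 1) of λ where
      (yes h) → via true f′≡ (f-odd-flip S? (true ∷ α) (cong not e) (λ ()) h) λ _ →
                  head-odd-1 S? (flip α 1) (odd-flip₁ e) h
      (no ¬h) → via true f′≡ (f-odd-flip2 S? (true ∷ α) (cong not e) (λ ()) ¬h)
                  (head-odd-0 S? (flip α 1) (odd-flip₁ e) ¬h)
    where
    f′≡ : f S′? α ≡ flip α 1
    f′≡ = f-even-flip S′? α e (1∷∈⇒t≡1 S? L 0∈S α 1α∈) (inj₁ refl)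

-- Induction on the length.

CyclicNext-f : {S : Pred (Bits (suc m)) p} (S? : Decidable S) →
  FlipSwapLanguage S → 0^ suc m ∈ S → 0^ m ∷ʳ true ∈ S →
  (α : Bits (suc m)) → α ∈ S → CyclicNext (𝓑𝓡𝓖𝓒 S?) α (f S? α)
CyclicNext-f {m = zero} {S = S} S? L 0∈S 1∈S = λ where
    (false ∷ []) _ → next [] [] (trans listing (cong (λ β → _ ∷ β ∷ []) (sym f0≡1)))
    (true  ∷ []) _ → wrap (cong last listing)
                       (trans (cong head listing) (cong just (sym (f-last S? (true ∷ []) refl))))
  where
  listing : 𝓑𝓡𝓖𝓒 S? ≡ (false ∷ []) ∷ (true ∷ []) ∷ []
  listing = trans (filter-accept S? 0∈S) (cong (_ ∷_) (filter-accept S? 1∈S))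

  f0≡1 : f S? (false ∷ []) ≡ true ∷ []
  f0≡1 = f-even-flip S? (false ∷ []) refl (t-here S? 1∈S) (inj₁ refl)
CyclicNext-f {m = suc m} {S = S} S? L 0∈S l∈S α α∈S =
  subst (λ l → CyclicNext l α (f S? α)) (sym listing) (go α α∈S)
  where
  S′? : Decidable (Tails S)
  S′? = Tails? S?

  g : Bits (suc m) → List (Bits (suc (suc m)))
  g = filter S? ∘ block

  listing : 𝓑𝓡𝓖𝓒 S? ≡ concatMap g (𝓑𝓡𝓖𝓒 S′?)
  listing = trans (cong (filter S?) (BRGC-suc (suc m))) (filter-concatMap-block S? L 0∈S (BRGC (suc m)))

  ih : (β : Bits (suc m)) → β ∈ Tails S → CyclicNext (𝓑𝓡𝓖𝓒 S′?) β (f S′? β)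
  -- `0∈S` and `l∈S` serve for the tails as they stand, since both strings begin with 0; this is why
  -- the induction uses `l∈S` in place of `AtLeastTwo`.
  ih = CyclicNext-f S′? (FlipSwapLanguage-Tails L) 0∈S l∈S

  f-∈ : (β : Bits (suc m)) → β ∈ Tails S → f S′? β ∈ Tails S
  -- By induction the successor occurs in the filtered listing, hence satisfies its predicate.
  f-∈ β β∈ = proj₂ (∈-filter⁻ S′? {xs = BRGC (suc m)} (CyclicNext⇒∈ʳ (ih β β∈)))

  via : ∀ γ {δ} → f S? γ ≡ δ → CyclicNext (concatMap g (𝓑𝓡𝓖𝓒 S′?)) γ δ →
    CyclicNext (concatMap g (𝓑𝓡𝓖𝓒 S′?)) γ (f S? γ)
  via _ refl c = c

  go : (α : Bits (suc (suc m))) → α ∈ S → CyclicNext (concatMap g (𝓑𝓡𝓖𝓒 S′?)) α (f S? α)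
  go (false ∷ β) β∈ = by-parity (even β) refl
    where
    by-parity : ∀ b → even β ≡ b → CyclicNext (concatMap g (𝓑𝓡𝓖𝓒 S′?)) (false ∷ β) (f S? (false ∷ β))
    by-parity false e = CyclicNext-concatMap g (ih β β∈) (last-odd S? β e β∈)
                          (head-f-false-odd S? L 0∈S l∈S β β∈ (f-∈ β β∈) e)
    by-parity true  e = case S? (true ∷ β) of λ where
      -- Both elements of the block survive, so `t` is 1 and `f` flips the first bit, which is the
      -- step inside the block.
      (yes 1β∈) → via (false ∷ β) (f-even-flip S? (false ∷ β) e (t-here S? 1β∈) (inj₁ refl))
                    (CyclicNext-inner g (CyclicNext⇒∈ˡ (ih β β∈)) (block-even S? β e β∈ 1β∈))
      (no  1β∉) → CyclicNext-concatMap g (ih β β∈) (last-even-0 S? β e 1β∉ β∈)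
                    (head-f-false-even S? L 0∈S l∈S β β∈ (f-∈ β β∈) e 1β∉)
  go (true ∷ β) 1β∈ = by-parity (even β) refl
    where
    β∈ : β ∈ Tails S
    β∈ = flip₁ L 0∈S 1β∈

    by-parity : ∀ b → even β ≡ b → CyclicNext (concatMap g (𝓑𝓡𝓖𝓒 S′?)) (true ∷ β) (f S? (true ∷ β))
    by-parity true  e = CyclicNext-concatMap g (ih β β∈) (last-even-1 S? β e 1β∈)
                          (head-f-true-even S? L 0∈S l∈S β β∈ (f-∈ β β∈) e 1β∈)
    -- An odd `β` makes `true ∷ β` even and the first of its block; flipping the leading 1 gives the
    -- second.
    by-parity false e = via (true ∷ β) (f-even-flip S? (true ∷ β) (cong not e) (t-here S? β∈) (inj₁ refl))
                          (CyclicNext-inner g (CyclicNext⇒∈ˡ (ih β β∈)) (block-odd S? β e β∈ 1β∈))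

theorem4 : ∀ {p : Level} (m : ℕ) (S : Pred (Bits (suc m)) p) (S? : Decidable S) →
    FlipSwapLanguage S →
    0^ (suc m) ∈ S →
    AtLeastTwo S →
    ∀ (α : Bits (suc m)) → α ∈ S → CyclicNext (𝓑𝓡𝓖𝓒 S?) α (f S? α)
theorem4 m S S? L 0∈S two = CyclicNext-f S? L 0∈S (AtLeastTwo⇒last∈ L 0∈S two)
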